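{- The four cardinals $\mathfrak{f}$, $\mathfrak{f}_1$, $\mathfrak{f}_2$ and $\mathfrak{e}_{ubd}$ (defined in the context) are equal: $\mathfrak{f} = \mathfrak{f}_1 = \mathfrak{f}_2 = \mathfrak{e}_{ubd}$.
   Context: Notation: $\omega$ is the set of natural numbers, ${}^{\omega}\omega$ the set of functions $\omega\to\omega$, ${}^{n}\omega$ the set of sequences of natural numbers of length $n$, $[\omega]^{\omega}$ the set of infinite subsets of $\omega$, and $[\omega]^{\leq m}$ the set of subsets of $\omega$ of size at most $m$. $\exists^\infty n$ means "there are infinitely many $n$". For $X,Y\subseteq\omega$, $X\subseteq^* Y$ means that $X\setminus Y$ is finite. $\mathcal{P}(\omega)$ is identified with ${}^{\omega}2$ via characteristic functions and carries the product topology of the discrete space $\{0,1\}$; "F$_\sigma$" (countable union of closed sets) refers to this topology. A filter is a collection of subsets of $\omega$ closed under finite intersections and supersets and containing all cofinite sets; all filters are assumed proper, i.e. they contain only infinite sets. The filter generated by $\mathcal{X}\subseteq[\omega]^\omega$ is the smallest filter containing each member of $\mathcal{X}$. An infinite set $X\in[\omega]^\omega$ diagonalizes a filter $\mathcal{F}$ if $X\subseteq^* Y$ for every $Y\in\mathcal{F}$. A filter is non trivial if no single infinite set diagonalizes it. A family $\mathcal{H}\subseteq{}^{\omega}\omega$ is bounded if there is $b\in{}^{\omega}\omega$ such that for every $h\in\mathcal{H}$, $h(n)\leq b(n)$ for all but finitely many $n$. Definitions of the cardinals: - $\mathfrak{f}$ is the minimum of $|\mathcal{X}|$ over all $\mathcal{X}\subseteq[\omega]^{\omega}$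 that generate a non trivial filter included in some F$_\sigma$ filter. - $\mathfrak{f}_1$ is the minimum of $|\mathcal{H}|$ over all bounded $\mathcal{H}\subseteq{}^{\omega}\omega$ such that for some $g\in{}^{\omega}\omega$ with $\lim_{n\to\infty}g(n)=\infty$: for every $X\in[\omega]^{\omega}$ and every sequence $\langle s_n : n\in\omega\rangle$ with $s_n\in[\omega]^{\leq g(n)}$, there is $h\in\mathcal{H}$ with $(\exists^\infty n\in X)\; h(n)\notin s_n$. - $\mathfrak{f}_2$ is the minimum of $|\mathcal{H}|$ over all bounded $\mathcal{H}\subseteq{}^{\omega}\omega$ such that for some $g\in{}^{\omega}\omega$ with $\lim_{n\to\infty}g(n)=\infty$: for every $X\in[\omega]^{\omega}$ and every sequence of functions $\pi_n:{}^{n}\omega\to[\omega]^{\leq g(n)}$ ($n\in\omega$), there is $h\in\mathcal{H}$ with $(\exists^\infty n\in X)\; h(n)\notin\pi_n(h\restriction n)$. - $\mathfrak{e}_{ubd}$ is the minimum of $|\mathcal{H}|$ over all bounded $\mathcal{H}\subseteq{}^{\omega}\omega$ such that for every $X\in[\omega]^{\omega}$ and every sequence of functions $\pi_n:{}^{n}\omega\to\omega$ ($n\in\omega$), there is $h\in\mathcal{H}$ with $(\exists^\infty n\in X)\; h(n)\neq\pi_n(h\restriction n)$. -}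

module Defs where

open import Axiom.ExcludedMiddle using (ExcludedMiddle)
open import Axiom.Extensionality.Propositional using (Extensionality)
open import Data.Bool.Base using (Bool; T; not; _∧_)
open import Data.Fin.Base using (Fin; toℕ)
open import Data.List.Base using (List)
open import Data.List.Relation.Unary.All using (All)
open import Data.Nat.Base using (ℕ; _≤_)
open import Data.Product.Base using (Σ; ∃; _×_; proj₁)
open import Data.Vec.Base using (Vec; tabulate)
open import Function.Base using (_∘_)
open import Function.Bundles using (_↔_; _↣_; _⇔_)
open import Level using (0ℓ; Setω)
open import Relation.Binary.PropositionalEquality.Core using (_≡_; _≢_)
open import Relation.Nullary.Negation.Core using (¬_)
open import Relation.Unary using (Pred)

-- The ambient classical set theory.  Excluded middle ranges over all types,
-- not only propositions, so it decides Σ-types and thereby acts as a choice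
-- operator; with function extensionality it also chooses representatives of
-- equivalence classes.  Together they play the role of the axiom of choice.

record Classical : Setω where
  field
    lem    : ∀ {ℓ} → ExcludedMiddle ℓ
    funext : ∀ {a b} → Extensionality a b

-- Subsets are characteristic functions.  Under excluded middle every predicate
-- has one, and membership proofs are unique, so that ∣ S ∣ below has exactly
-- one inhabitant per element of S.

𝒫 : Set → Set
𝒫 A = A → Bool

infix 4 _∈_ _∉_ _⊆_ _⊆*_ _≤ᶜ_
infixr 7 _∩_
infixl 6 _∖_

_∈_ _∉_ : {A : Set} → A → 𝒫 A → Set
x ∈ S = T (S x)
x ∉ S = ¬ (x ∈ S)

_⊆_ : {A : Set} → 𝒫 A → 𝒫 A → Set
S ⊆ S′ = ∀ x → x ∈ S → x ∈ S′

∁ : {A : Set} → 𝒫 A → 𝒫 A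
∁ S x = not (S x)

_∩_ _∖_ : {A : Set} → 𝒫 A → 𝒫 A → 𝒫 A
(S ∩ S′) x = S x ∧ S′ x
S ∖ S′ = S ∩ ∁ S′

-- Cardinals are types up to bijection, ordered by injections.

∣_∣ : {A : Set} → 𝒫 A → Set
∣ S ∣ = Σ _ (_∈ S)

_≤ᶜ_ : Set → Set → Set
κ ≤ᶜ μ = κ ↣ μ

-- κ = min { ∣ S ∣ : P S }

record IsMinCard {A : Set} (P : Pred (𝒫 A) 0ℓ) (κ : Set) : Set where
  field
    attained : ∃ λ S → P S × (∣ S ∣ ↔ κ)
    least    : ∀ S → P S → κ ≤ᶜ ∣ S ∣

∃∞ ∀∞ : Pred ℕ 0ℓ → Set
∃∞ P = ∀ m → ∃ λ n → m ≤ n × P n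
∀∞ P = ∃ λ m → ∀ n → m ≤ n → P n

Infinite Finite Cofinite : 𝒫 ℕ → Set
Infinite X = ∃∞ (_∈ X)
Finite   X = ∀∞ (_∉ X)
Cofinite X = Finite (∁ X)

_⊆*_ : 𝒫 ℕ → 𝒫 ℕ → Set
X ⊆* Y = Finite (X ∖ Y)

[ω]^≤ : ℕ → Set
[ω]^≤ m = Σ (𝒫 ℕ) λ S → ∣ S ∣ ≤ᶜ Fin m

-- The product topology on ℕ → Bool: a basic neighbourhood of X fixes the
-- values of X at finitely many coordinates.

IsOpen IsClosed IsFσ : 𝒫 (𝒫 ℕ) → Set
IsOpen 𝓤 = ∀ X → X ∈ 𝓤 →
  ∃ λ (is : List ℕ) → ∀ Y → All (λ i → Y i ≡ X i) is → Y ∈ 𝓤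
IsClosed 𝓒 = IsOpen (∁ 𝓒)
IsFσ 𝓕 = ∃ λ (𝓒 : ℕ → 𝒫 (𝒫 ℕ)) →
  (∀ k → IsClosed (𝓒 k)) × (∀ X → X ∈ 𝓕 ⇔ (∃ λ k → X ∈ 𝓒 k))

record IsFilter (𝓕 : 𝒫 (𝒫 ℕ)) : Set where
  field
    ∩-closed : ∀ X Y → X ∈ 𝓕 → Y ∈ 𝓕 → X ∩ Y ∈ 𝓕
    ⊆-closed : ∀ X Y → X ∈ 𝓕 → X ⊆ Y → Y ∈ 𝓕
    cofinite : ∀ X → Cofinite X → X ∈ 𝓕
    proper   : ∀ X → X ∈ 𝓕 → Infinite X

record Generates (𝓧 𝓕 : 𝒫 (𝒫 ℕ)) : Set where
  field
    isFilter : IsFilter 𝓕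
    contains : 𝓧 ⊆ 𝓕
    smallest : ∀ 𝓖 → IsFilter 𝓖 → 𝓧 ⊆ 𝓖 → 𝓕 ⊆ 𝓖

Diagonalizes : 𝒫 ℕ → 𝒫 (𝒫 ℕ) → Set
Diagonalizes X 𝓕 = ∀ Y → Y ∈ 𝓕 → X ⊆* Y

NonTrivial : 𝒫 (𝒫 ℕ) → Set
NonTrivial 𝓕 = ¬ (∃ λ X → Infinite X × Diagonalizes X 𝓕)

Bounded : 𝒫 (ℕ → ℕ) → Set
Bounded 𝓗 = ∃ λ (b : ℕ → ℕ) → ∀ h → h ∈ 𝓗 → ∀∞ λ n → h n ≤ b n

TendsTo∞ : (ℕ → ℕ) → Set
TendsTo∞ g = ∀ k → ∀∞ λ n → k ≤ g n

_↾_ : (ℕ → ℕ) → (n : ℕ) → Vec ℕ n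
h ↾ n = tabulate {n = n} (h ∘ toℕ)

𝔣-family : Pred (𝒫 (𝒫 ℕ)) 0ℓ
𝔣-family 𝓧 =
  (∀ X → X ∈ 𝓧 → Infinite X) ×
  ∃ λ 𝓕 → Generates 𝓧 𝓕 × NonTrivial 𝓕 ×
    ∃ λ 𝓖 → IsFilter 𝓖 × IsFσ 𝓖 × 𝓕 ⊆ 𝓖

𝔣₁-family 𝔣₂-family 𝔢ubd-family : Pred (𝒫 (ℕ → ℕ)) 0ℓ
𝔣₁-family 𝓗 =
  Bounded 𝓗 ×
  ∃ λ g → TendsTo∞ g ×
    (∀ X → Infinite X → (s : ∀ n → [ω]^≤ (g n)) →
      ∃ λ h → h ∈ 𝓗 × ∃∞ λ n → n ∈ X × h n ∉ proj₁ (s n))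
𝔣₂-family 𝓗 =
  Bounded 𝓗 ×
  ∃ λ g → TendsTo∞ g ×
    (∀ X → Infinite X → (π : ∀ n → Vec ℕ n → [ω]^≤ (g n)) →
      ∃ λ h → h ∈ 𝓗 × ∃∞ λ n → n ∈ X × h n ∉ proj₁ (π n (h ↾ n)))
𝔢ubd-family 𝓗 =
  Bounded 𝓗 ×
  (∀ X → Infinite X → (π : ∀ n → Vec ℕ n → ℕ) →
    ∃ λ h → h ∈ 𝓗 × ∃∞ λ n → n ∈ X × h n ≢ π n (h ↾ n))

Is𝔣 Is𝔣₁ Is𝔣₂ Is𝔢ubd : Set → Set
Is𝔣    = IsMinCard 𝔣-family
Is𝔣₁   = IsMinCard 𝔣₁-family
Is𝔣₂   = IsMinCard 𝔣₂-family
Is𝔢ubd = IsMinCard 𝔢ubd-family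

{-# OPTIONS --safe #-}
module Submission where

-- Each family of one kind yields a family of the next kind, of no larger
-- cardinality, around two cycles through 𝔣₁.
-- 𝔣 to 𝔣₁: by compactness of the closed pieces of the Fσ filter there are
-- windows [n, M n) met by every intersection of n members of its first pieces;
-- send X to its traces below M n.  A slalom catching all traces selects a point
-- in each window, and these points diagonalize the filter.
-- 𝔣₁ to 𝔣: send h to the set of pairs (n, S) with |S| ≤ g n and h n ∈ S.  An
-- infinite set almost contained in all of these is a slalom catching all h.
-- 𝔣₁ to 𝔣₂: restrict h to a sparse sequence of arguments.
-- 𝔣₂ to 𝔢ubd: a single value is a slalom of width one.
-- 𝔢ubd to 𝔣₁: send h to its restrictions to k + k + 1.  If k candidates for
-- such a restriction are given, then at some level between k and k + k none of
-- them branch, so there h n is determined by h ↾ n.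

open import Defs
open import Data.Bool.Base using (Bool; true; false; T)
open import Data.Bool.Properties using (T-∧; T-≡; T-irrelevant)
open import Data.Empty using (⊥; ⊥-elim)
open import Data.Fin.Base using (Fin; zero; suc; toℕ; fromℕ<; combine; punchOut)
open import Data.Fin.Properties
  using (_≟_; toℕ-injective; toℕ<n; toℕ-fromℕ<; inject≤-injective; combine-injective;
         punchOut-injective; injective⇒≤)
open import Data.List.Base using (List; []; _∷_; upTo)
open import Data.List.Membership.Propositional.Properties using (∈-upTo⁺)
open import Data.List.Relation.Unary.All as All using (All; []; _∷_)
open import Data.Nat.Base
  using (ℕ; zero; suc; _+_; _*_; _≤_; _<_; _⊔_; _⊓_; z≤n; s≤s)
open import Data.Nat.Properties hiding (_≟_)
open import Data.Product.Base using (Σ; ∃; _×_; _,_; proj₁; proj₂; map₂)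
open import Data.Sum.Base using (_⊎_; inj₁; inj₂; [_,_]′)
open import Data.Unit.Base using (⊤; tt)
open import Data.Vec.Base using (Vec; lookup)
open import Data.Vec.Properties using (lookup∘tabulate; tabulate-cong)
open import Function.Base using (_∘_; id; case_of_)
open import Function.Bundles
  using (_↔_; mk↣; mk⤖; mk⇔; module Injection; module Equivalence)
open import Function.Construct.Composition using (_↣-∘_)
open import Function.Construct.Identity using (↣-id; ↔-id)
open import Function.Properties.Bijection using (⤖⇒↔)
open import Level using (0ℓ)
open import Relation.Binary.Definitions using (tri<; tri≈; tri>)
open import Relation.Binary.PropositionalEquality
  using (_≡_; _≢_; refl; sym; trans; cong; subst; module ≡-Reasoning)
open import Relation.Nullary using (¬_; Dec; yes; no; contradiction)
open import Relation.Nullary.Decidable using (⌊_⌋; toWitness; fromWitness; decidable-stable)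
open import Relation.Unary using (Pred)

-- Coding of finite sequences

-- The diagonal `x + y = s` takes codes from `s * s` to `s * s + s`, all below the square of
-- `s + 1`. This gives injectivity and monotonicity in both arguments; some numbers are not codes.
pair : ℕ → ℕ → ℕ
pair x y = (x + y) * (x + y) + x

pair-mono : ∀ {x x′ y y′} → x ≤ x′ → y ≤ y′ → pair x y ≤ pair x′ y′
pair-mono p q = +-mono-≤ (*-mono-≤ (+-mono-≤ p q) (+-mono-≤ p q)) p

≤-pairˡ : ∀ x y → x ≤ pair x y
≤-pairˡ x y = m≤n+m x _

+-<⇒pair-< : ∀ x y x′ y′ → x + y < x′ + y′ → pair x y < pair x′ y′
+-<⇒pair-< x y x′ y′ lt = begin-strict
  s * s + x        ≤⟨ +-monoʳ-≤ (s * s) (m≤m+n x y) ⟩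
  s * s + s        ≡⟨ +-comm (s * s) s ⟩
  suc s * s        <⟨ *-monoʳ-< (suc s) (n<1+n s) ⟩
  suc s * suc s    ≤⟨ *-mono-≤ lt lt ⟩
  s′ * s′          ≤⟨ m≤m+n (s′ * s′) x′ ⟩
  pair x′ y′       ∎
  where
  open ≤-Reasoning
  s  = x + y
  s′ = x′ + y′

pair-injective : ∀ x y x′ y′ → pair x y ≡ pair x′ y′ → x ≡ x′ × y ≡ y′
pair-injective x y x′ y′ eq with <-cmp (x + y) (x′ + y′)
... | tri< lt _ _ = contradiction eq (<⇒≢ (+-<⇒pair-< x y x′ y′ lt))
... | tri> _ _ gt = contradiction (sym eq) (<⇒≢ (+-<⇒pair-< x′ y′ x y gt))
... | tri≈ _ s≡s′ _ = x≡x′ , y≡y′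
  where
  x≡x′ : x ≡ x′
  x≡x′ = +-cancelˡ-≡ ((x + y) * (x + y)) x x′
           (trans eq (cong (λ s → s * s + x′) (sym s≡s′)))
  y≡y′ : y ≡ y′
  y≡y′ = +-cancelˡ-≡ x y y′ (trans s≡s′ (cong (_+ y′) (sym x≡x′)))

-- The length is not recorded: codes are compared only at a common `k`.
code : (ℕ → ℕ) → ℕ → ℕ
code f zero    = zero
code f (suc k) = pair (f k) (code f k)

code-mono : ∀ {f g} k → (∀ i → f i ≤ g i) → code f k ≤ code g k
code-mono zero    f≤g = z≤n
code-mono (suc k) f≤g = pair-mono (f≤g k) (code-mono k f≤g)

code-injective : ∀ f g k → code f k ≡ code g k → ∀ i → i < k → f i ≡ g i
code-injective f g (suc k) eq i i<1+k with pair-injective (f k) _ (g k) _ eq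
... | fk≡gk , eq′ with m≤n⇒m<n∨m≡n (≤-pred i<1+k)
...   | inj₁ i<k  = code-injective f g k eq′ i i<k
...   | inj₂ refl = fk≡gk

b2n : Bool → ℕ
b2n true  = 1
b2n false = 0

b2n-injective : ∀ {x y} → b2n x ≡ b2n y → x ≡ y
b2n-injective {true}  {true}  _ = refl
b2n-injective {false} {false} _ = refl

b2n≤1 : ∀ x → b2n x ≤ 1
b2n≤1 true  = ≤-refl
b2n≤1 false = z≤n

codeˢ : 𝒫 ℕ → ℕ → ℕ
codeˢ S = code (b2n ∘ S)

maxCodeˢ : ℕ → ℕ
maxCodeˢ = code (λ _ → 1)

codeˢ≤max : ∀ S k → codeˢ S k ≤ maxCodeˢ k
codeˢ≤max S k = code-mono k (b2n≤1 ∘ S)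

codeˢ-injective : ∀ S S′ k → codeˢ S k ≡ codeˢ S′ k → ∀ i → i < k → S i ≡ S′ i
codeˢ-injective S S′ k eq i i<k = b2n-injective (code-injective (b2n ∘ S) (b2n ∘ S′) k eq i i<k)

-- Restrictions, bounds and subsets

↾-cong : ∀ {f g : ℕ → ℕ} n → (∀ i → i < n → f i ≡ g i) → f ↾ n ≡ g ↾ n
↾-cong n f≗g = tabulate-cong (λ i → f≗g (toℕ i) (toℕ<n i))

↾-injective : ∀ (f g : ℕ → ℕ) n → f ↾ n ≡ g ↾ n → ∀ i → i < n → f i ≡ g i
↾-injective f g n eq i i<n = begin
  f i                      ≡⟨ sym (at f) ⟩
  lookup (f ↾ n) (fromℕ< i<n) ≡⟨ cong (λ v → lookup v (fromℕ< i<n)) eq ⟩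
  lookup (g ↾ n) (fromℕ< i<n) ≡⟨ at g ⟩
  g i                      ∎
  where
  open ≡-Reasoning
  at : ∀ h → lookup (h ↾ n) (fromℕ< i<n) ≡ h i
  at h = trans (lookup∘tabulate (h ∘ toℕ) (fromℕ< i<n)) (cong h (toℕ-fromℕ< i<n))

-- `K` exceeds the finitely many values of `M` below `N`. This turns large values into large
-- arguments even if `M` is neither monotone nor injective.
bounded-below : ∀ (M : ℕ → ℕ) N → ∃ λ K → ∀ n → K ≤ M n → N ≤ n
bounded-below M zero = 0 , λ _ _ → z≤n
bounded-below M (suc N) with bounded-below M N
... | K , K-bound = K ⊔ suc (M N) , λ n le →
  ≤∧≢⇒< (K-bound n (≤-trans (m≤m⊔n K _) le))
    λ { refl → n≮n (M N) (≤-trans (m≤n⊔m K _) le) }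

list-bound : (is : List ℕ) → ∃ λ N → All (_< N) is
list-bound [] = 0 , []
list-bound (i ∷ is) with list-bound is
... | N , is<N = suc i ⊔ N , m≤m⊔n (suc i) N ∷ All.map (λ lt → ≤-trans lt (m≤n⊔m (suc i) N)) is<N

full : 𝒫 ℕ
full _ = true

∅ : 𝒫 ℕ
∅ _ = false

∈-∩⁺ : {A : Set} (X Y : 𝒫 A) {x : A} → x ∈ X → x ∈ Y → x ∈ X ∩ Y
∈-∩⁺ X Y {x} p q = Equivalence.from (T-∧ {X x} {Y x}) (p , q)

∈-∩⁻ : {A : Set} (X Y : 𝒫 A) {x : A} → x ∈ X ∩ Y → x ∈ X × x ∈ Y
∈-∩⁻ X Y {x} = Equivalence.to (T-∧ {X x} {Y x})

∉⇒∈∁ : {A : Set} (X : 𝒫 A) {x : A} → x ∉ X → x ∈ ∁ X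
∉⇒∈∁ X {x} x∉X with X x
... | true  = ⊥-elim (x∉X tt)
... | false = tt

∈∁⇒∉ : {A : Set} (X : 𝒫 A) {x : A} → x ∈ ∁ X → x ∉ X
∈∁⇒∉ X {x} p q with X x
... | true = p

∉∁⇒∈ : {A : Set} (X : 𝒫 A) {x : A} → x ∉ ∁ X → x ∈ X
∉∁⇒∈ X {x} p with X x
... | true  = tt
... | false = p tt

⊆*⁺ : ∀ X Y → (∀∞ λ n → n ∈ X → n ∈ Y) → X ⊆* Y
⊆*⁺ X Y (m , sub) = m , λ n m≤n n∈ →
  let n∈X , n∈∁Y = ∈-∩⁻ X (∁ Y) n∈ in ∈∁⇒∉ Y n∈∁Y (sub n m≤n n∈X)

⊆*⁻ : ∀ X Y → X ⊆* Y → ∀∞ λ n → n ∈ X → n ∈ Y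
⊆*⁻ X Y (m , fin) = m , λ n m≤n n∈X →
  ∉∁⇒∈ Y (λ n∈∁Y → fin n m≤n (∈-∩⁺ X (∁ Y) n∈X n∈∁Y))

𝒫-ext : Classical → {A : Set} (X Y : 𝒫 A) → X ⊆ Y → Y ⊆ X → X ≡ Y
𝒫-ext cl X Y X⊆Y Y⊆X = Classical.funext cl λ x → T-ext (X⊆Y x) (Y⊆X x)
  where
  T-ext : ∀ {x y} → (T x → T y) → (T y → T x) → x ≡ y
  T-ext {true}  {true}  _ _ = refl
  T-ext {true}  {false} f _ = ⊥-elim (f tt)
  T-ext {false} {true}  _ g = ⊥-elim (g tt)
  T-ext {false} {false} _ _ = refl

∣∣-≡ : {A : Set} {S : 𝒫 A} {x y : ∣ S ∣} → proj₁ x ≡ proj₁ y → x ≡ y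
∣∣-≡ {x = x , p} {y = .x , q} refl = cong (x ,_) (T-irrelevant p q)

-- Choice and negation from excluded middle

module _ (classical : Classical) where
  open Classical classical

  byContradiction : ∀ {ℓ} {A : Set ℓ} → ¬ ¬ A → A
  byContradiction = decidable-stable lem

  abstract
    ⟦_⟧ : {A : Set} → Pred A 0ℓ → 𝒫 A
    ⟦ P ⟧ x = ⌊ lem {P = P x} ⌋

    ∈⟦⟧⁺ : {A : Set} (P : Pred A 0ℓ) {x : A} → P x → x ∈ ⟦ P ⟧
    ∈⟦⟧⁺ P = fromWitness

    ∈⟦⟧⁻ : {A : Set} (P : Pred A 0ℓ) {x : A} → x ∈ ⟦ P ⟧ → P x
    ∈⟦⟧⁻ P = toWitness

    -- Hilbert's epsilon: excluded middle at the Σ-type itself hands over a witness, and `d` is the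
    -- value when there is none.
    ε : ∀ {ℓ} {A : Set} → Pred A ℓ → A → A
    ε P d with lem {P = ∃ P}
    ... | yes (x , _) = x
    ... | no _        = d

    ε-satisfies : ∀ {ℓ} {A : Set} (P : Pred A ℓ) d → ∃ P → P (ε P d)
    ε-satisfies P d ex with lem {P = ∃ P}
    ... | yes (_ , px) = px
    ... | no ¬ex       = contradiction ex ¬ex

    ε-satisfies-or-default : ∀ {ℓ} {A : Set} (P : Pred A ℓ) d → P (ε P d) ⊎ ε P d ≡ d
    ε-satisfies-or-default P d with lem {P = ∃ P}
    ... | yes (_ , px) = inj₁ px
    ... | no _         = inj₂ refl

  ¬∀⇒∃¬ : ∀ {a p} {A : Set a} {P : Pred A p} → ¬ (∀ x → P x) → ∃ λ x → ¬ P x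
  ¬∀⇒∃¬ ¬∀ = byContradiction λ ¬∃ → ¬∀ λ x → byContradiction λ ¬px → ¬∃ (x , ¬px)

  ¬∃∞⇒∀∞¬ : {P : Pred ℕ 0ℓ} → ¬ ∃∞ P → ∀∞ (λ n → ¬ P n)
  ¬∃∞⇒∀∞¬ ¬inf with ¬∀⇒∃¬ ¬inf
  ... | m , ¬ex = m , λ n m≤n pn → ¬ex (n , m≤n , pn)

  -- Comparison of cardinals

  module CantorBernstein {A B : Set} (A↣B : A ≤ᶜ B) (B↣A : B ≤ᶜ A) where
    open Injection A↣B using () renaming (to to f; injective to f-injective)
    open Injection B↣A using () renaming (to to g; injective to g-injective)

    -- The elements whose backward chain under `g` and `f` stops in `A`, outside the range of `g`.
    -- The bijection is `f` on these and the inverse of `g` on the others.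
    data Forward : A → Set where
      start : ∀ {a} → ¬ (∃ λ b → g b ≡ a) → Forward a
      next  : ∀ {a} → Forward a → Forward (g (f a))

    preimage : ∀ {a} → ¬ Forward a → ∃ λ b → g b ≡ a
    preimage ¬fwd = byContradiction (¬fwd ∘ start)

    φ′ : ∀ a → Dec (Forward a) → B
    φ′ a (yes _)   = f a
    φ′ a (no ¬fwd) = proj₁ (preimage ¬fwd)

    φ : A → B
    φ a = φ′ a lem

    separate : ∀ {a a′} → Forward a → (¬fwd : ¬ Forward a′) → f a ≢ proj₁ (preimage ¬fwd)
    separate fwd ¬fwd eq =
      ¬fwd (subst Forward (trans (cong g eq) (proj₂ (preimage ¬fwd))) (next fwd))

    φ′-injective : ∀ a a′ d d′ → φ′ a d ≡ φ′ a′ d′ → a ≡ a′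
    φ′-injective a a′ (yes _)   (yes _)    eq = f-injective eq
    φ′-injective a a′ (yes fwd) (no ¬fwd)  eq = contradiction eq (separate fwd ¬fwd)
    φ′-injective a a′ (no ¬fwd) (yes fwd)  eq = contradiction (sym eq) (separate fwd ¬fwd)
    φ′-injective a a′ (no ¬fwd) (no ¬fwd′) eq =
      trans (sym (proj₂ (preimage ¬fwd))) (trans (cong g eq) (proj₂ (preimage ¬fwd′)))

    φ-injective : ∀ {a a′} → φ a ≡ φ a′ → a ≡ a′
    φ-injective = φ′-injective _ _ lem lem

    fwd-value : ∀ {a} d → Forward a → φ′ a d ≡ f a
    fwd-value (yes _)   _   = refl
    fwd-value (no ¬fwd) fwd = contradiction fwd ¬fwd

    nonfwd-value : ∀ b d → ¬ Forward (g b) → φ′ (g b) d ≡ b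
    nonfwd-value b (yes fwd) ¬fwd = contradiction fwd ¬fwd
    nonfwd-value b (no ¬fwd) _    = g-injective (proj₂ (preimage ¬fwd))

    hit′ : ∀ b {a} → Forward a → a ≡ g b → ∃ λ a → φ a ≡ b
    hit′ b (start ¬im) refl = contradiction (b , refl) ¬im
    hit′ b (next {a} fwd) eq = a , trans (fwd-value lem fwd) (g-injective eq)

    -- If `g b` is forward, it cannot be a start, so it is `g (f a)` with `a` forward and `a` is
    -- sent to `b`; otherwise `g b` itself is sent to `b`.
    hit : ∀ b → ∃ λ a → φ a ≡ b
    hit b with lem {P = Forward (g b)}
    ... | yes fwd = hit′ b fwd refl
    ... | no ¬fwd = g b , nonfwd-value b lem ¬fwd

    φ-surjective : ∀ b → ∃ λ a → ∀ {z} → z ≡ a → φ z ≡ b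
    φ-surjective b = proj₁ (hit b) , λ { refl → proj₂ (hit b) }

    cantor-bernstein : A ↔ B
    cantor-bernstein = ⤖⇒↔ (mk⤖ (φ-injective , φ-surjective))

  open CantorBernstein using (cantor-bernstein)

  -- A maximal set of choice functions on which every projection is injective
  -- has a surjective projection, whose inverse injects that factor into all
  -- the others.  The maximal set is the top of a Bourbaki–Witt tower.
  module Smallest {I : Set} (A : I → Set) where

    Π : Set
    Π = ∀ i → A i

    Fresh : 𝒫 Π → Π → Set
    Fresh M x = ∀ i y → y ∈ M → y i ≢ x i

    ⋃ : 𝒫 (𝒫 Π) → 𝒫 Π
    ⋃ J = ⟦ (λ x → ∃ λ M → M ∈ J × x ∈ M) ⟧

    new : (M : 𝒫 Π) → Dec (∃ (Fresh M)) → Π → Set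
    new M (yes (y , _)) x = x ≡ y
    new M (no _)        x = ⊥

    Step : 𝒫 Π → Pred Π 0ℓ
    Step M x = x ∈ M ⊎ new M lem x

    step : 𝒫 Π → 𝒫 Π
    step M = ⟦ Step M ⟧

    ⊆-step : ∀ M → M ⊆ step M
    ⊆-step M x x∈M = ∈⟦⟧⁺ (Step M) (inj₁ x∈M)

    -- The empty set enters as the union over an empty `J`.
    data Tower : 𝒫 Π → Set where
      succ : ∀ {M} → Tower M → Tower (step M)
      sup  : ∀ J → (∀ M → M ∈ J → Tower M) → Tower (⋃ J)

    ∈-⋃⁺ : ∀ J {M} {x} → M ∈ J → x ∈ M → x ∈ ⋃ J
    ∈-⋃⁺ J M∈J x∈M = ∈⟦⟧⁺ _ (_ , M∈J , x∈M)

    ∈-⋃⁻ : ∀ J {x} → x ∈ ⋃ J → ∃ λ M → M ∈ J × x ∈ M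
    ∈-⋃⁻ J = ∈⟦⟧⁻ _

    -- The extreme points in the usual proof of the Bourbaki-Witt theorem.
    Good : 𝒫 Π → Set
    Good N = ∀ M → Tower M → M ⊆ N → ¬ (N ⊆ M) → step M ⊆ N

    -- Induction on the tower of `M`. At a successor with `M ⊆ N`, either the two are equal and have
    -- the same step, or the inclusion is strict and goodness applies.
    good-comparable : ∀ N → Good N → ∀ {M} → Tower M → M ⊆ N ⊎ step N ⊆ M
    good-comparable N good (succ {M} t) with good-comparable N good t
    ... | inj₂ N⁺⊆M = inj₂ λ x x∈ → ⊆-step M x (N⁺⊆M x x∈)
    ... | inj₁ M⊆N with lem {P = N ⊆ M}
    ...   | yes N⊆M = inj₂ (subst (λ K → step N ⊆ step K) (𝒫-ext classical N M N⊆M M⊆N) (λ _ → id))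
    ...   | no ¬N⊆M = inj₁ (good M t M⊆N ¬N⊆M)
    good-comparable N good (sup J ts)
      with lem {P = ∃ λ M → Σ (M ∈ J) λ _ → step N ⊆ M}
    ... | yes (M , M∈J , N⁺⊆M) = inj₂ λ x x∈ → ∈-⋃⁺ J M∈J (N⁺⊆M x x∈)
    ... | no ¬ex = inj₁ below
      where
      below : ⋃ J ⊆ N
      below x x∈ with ∈-⋃⁻ J x∈
      ... | M , M∈J , x∈M with good-comparable N good (ts M M∈J)
      ...   | inj₁ M⊆N  = M⊆N x x∈M
      ...   | inj₂ N⁺⊆M = contradiction (M , M∈J , N⁺⊆M) ¬ex

    tower-good : ∀ {N} → Tower N → Good N
    tower-good (succ {N} t) M tM M⊆N⁺ ¬N⁺⊆M with good-comparable N (tower-good t) tM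
    ... | inj₂ N⁺⊆M = contradiction N⁺⊆M ¬N⁺⊆M
    ... | inj₁ M⊆N with lem {P = N ⊆ M}
    ...   | yes N⊆M = subst (λ K → step M ⊆ step K) (𝒫-ext classical M N M⊆N N⊆M) (λ _ → id)
    ...   | no ¬N⊆M = λ x x∈ → ⊆-step N x (tower-good t M tM M⊆N ¬N⊆M x x∈)
    tower-good (sup J ts) M tM M⊆⋃ ¬⋃⊆M
      with lem {P = ∃ λ K → Σ (K ∈ J) λ _ → ¬ (K ⊆ M)}
    ... | no ¬ex = contradiction
      (λ x x∈ → let K , K∈J , x∈K = ∈-⋃⁻ J x∈ in
        byContradiction λ x∉M → ¬ex (K , K∈J , λ K⊆M → x∉M (K⊆M x x∈K)))
      ¬⋃⊆M
    ... | yes (K , K∈J , ¬K⊆M) with good-comparable K (tower-good (ts K K∈J)) tM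
    ...   | inj₁ M⊆K  = λ x x∈ → ∈-⋃⁺ J K∈J (tower-good (ts K K∈J) M tM M⊆K ¬K⊆M x x∈)
    ...   | inj₂ K⁺⊆M = contradiction (λ x x∈ → K⁺⊆M x (⊆-step K x x∈)) ¬K⊆M

    tower-chain : ∀ {M N} → Tower M → Tower N → M ⊆ N ⊎ N ⊆ M
    tower-chain tM tN with good-comparable _ (tower-good tN) tM
    ... | inj₁ M⊆N  = inj₁ M⊆N
    ... | inj₂ N⁺⊆M = inj₂ λ x x∈ → N⁺⊆M x (⊆-step _ x x∈)

    ProjectionsInjective : 𝒫 Π → Set
    ProjectionsInjective M = ∀ i x y → x ∈ M → y ∈ M → x i ≡ y i → x ≡ y

    step-injective : ∀ M → ProjectionsInjective M → ProjectionsInjective (step M)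
    step-injective M inj i x y x∈ y∈ eq = go lem (∈⟦⟧⁻ (Step M) x∈) (∈⟦⟧⁻ (Step M) y∈)
      where
      go : (d : Dec (∃ (Fresh M))) → x ∈ M ⊎ new M d x → y ∈ M ⊎ new M d y → x ≡ y
      go d (inj₁ p) (inj₁ q) = inj i x y p q eq
      go (yes (z , fresh)) (inj₁ p)    (inj₂ refl) = contradiction eq (fresh i x p)
      go (yes (z , fresh)) (inj₂ refl) (inj₁ q)    = contradiction (sym eq) (fresh i y q)
      go (yes (z , fresh)) (inj₂ refl) (inj₂ refl) = refl

    -- Since the tower is a chain, any two elements of a union already lie in one of its members.
    tower-injective : ∀ {M} → Tower M → ProjectionsInjective M
    tower-injective (succ t) = step-injective _ (tower-injective t)
    tower-injective (sup J ts) i x y x∈ y∈ eq with ∈-⋃⁻ J x∈ | ∈-⋃⁻ J y∈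
    ... | M , M∈J , x∈M | N , N∈J , y∈N with tower-chain (ts M M∈J) (ts N N∈J)
    ...   | inj₁ M⊆N = tower-injective (ts N N∈J) i x y (M⊆N x x∈M) y∈N eq
    ...   | inj₂ N⊆M = tower-injective (ts M M∈J) i x y x∈M (N⊆M y y∈N) eq

    top : 𝒫 Π
    top = ⋃ ⟦ Tower ⟧

    top-tower : Tower top
    top-tower = sup ⟦ Tower ⟧ (λ M → ∈⟦⟧⁻ Tower)

    -- The step of `top` is again in the tower, hence inside `top`; a fresh function added by it
    -- would have to differ from itself at `i`.
    top-maximal : I → ¬ ∃ (Fresh top)
    top-maximal i ex = go lem (λ x p → ∈⟦⟧⁺ (Step top) (inj₂ p))
      where
      go : (d : Dec (∃ (Fresh top))) → (∀ x → new top d x → x ∈ step top) → ⊥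
      go (no ¬ex)          _     = ¬ex ex
      go (yes (x , fresh)) added = fresh i x x∈top refl
        where
        x∈top : x ∈ top
        x∈top = ∈-⋃⁺ ⟦ Tower ⟧ (∈⟦⟧⁺ Tower (succ top-tower)) (added x refl)

    smallest : I → ∃ λ i → ∀ j → A i ≤ᶜ A j
    smallest i₀ = i , λ j → mk↣ {to = λ a → proj₁ (tuple a) j} λ {a} {a′} eq →
        let x , x∈ , xi≡a = tuple a ; y , y∈ , yi≡a′ = tuple a′ in
        trans (sym xi≡a)
          (trans (cong (λ z → z i) (tower-injective top-tower j x y x∈ y∈ eq)) yi≡a′)
      where
      surjective-projection : ∃ λ i → ∀ a → ∃ λ x → x ∈ top × x i ≡ a
      -- If every projection missed a value, the missed values would form a choice function fresh
      -- for `top`.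
      surjective-projection = byContradiction λ none →
        let missed = λ i → ¬∀⇒∃¬ {P = λ a → ∃ λ x → x ∈ top × x i ≡ a}
                             (λ surj → none (i , surj)) in
        top-maximal i₀ ((λ i → proj₁ (missed i)) ,
                        λ i y y∈ eq → proj₂ (missed i) (y , y∈ , eq))
      i = proj₁ surjective-projection
      tuple = proj₂ surjective-projection

  -- Images and the transfer of minima

  image : {A B : Set} → (A → B) → 𝒫 A → 𝒫 B
  image f S = ⟦ (λ y → ∃ λ x → x ∈ S × f x ≡ y) ⟧

  ∈-image⁺ : {A B : Set} (f : A → B) (S : 𝒫 A) {x : A} → x ∈ S → f x ∈ image f S
  ∈-image⁺ f S x∈S = ∈⟦⟧⁺ _ (_ , x∈S , refl)

  ∈-image⁻ : {A B : Set} (f : A → B) (S : 𝒫 A) {y : B} →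
             y ∈ image f S → ∃ λ x → x ∈ S × f x ≡ y
  ∈-image⁻ f S = ∈⟦⟧⁻ _

  ∣image∣≤ : {A B : Set} (f : A → B) (S : 𝒫 A) → ∣ image f S ∣ ≤ᶜ ∣ S ∣
  ∣image∣≤ f S = mk↣ {to = pre} λ {(y , p)} {(z , q)} eq →
      let _ , _ , fx≡y = ∈-image⁻ f S p ; _ , _ , fx′≡z = ∈-image⁻ f S q in
      ∣∣-≡ (trans (sym fx≡y) (trans (cong (f ∘ proj₁) eq) fx′≡z))
    where
    pre : ∣ image f S ∣ → ∣ S ∣
    pre (y , p) = let x , x∈S , _ = ∈-image⁻ f S p in x , x∈S

  infix 4 _⊑_
  -- In terms of minima: the cardinal of `Q` is at most that of `P`.
  _⊑_ : {A B : Set} → Pred (𝒫 A) 0ℓ → Pred (𝒫 B) 0ℓ → Set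
  P ⊑ Q = ∀ S → P S → ∃ λ S′ → Q S′ × ∣ S′ ∣ ≤ᶜ ∣ S ∣

  ⊑-trans : {A B C : Set} {P : Pred (𝒫 A) 0ℓ} {Q : Pred (𝒫 B) 0ℓ} {R : Pred (𝒫 C) 0ℓ} →
            P ⊑ Q → Q ⊑ R → P ⊑ R
  ⊑-trans P⊑Q Q⊑R S PS =
    let S′ , QS′ , S′≤S = P⊑Q S PS ; S″ , RS″ , S″≤S′ = Q⊑R S′ QS′ in
    S″ , RS″ , S′≤S ↣-∘ S″≤S′

  -- Indexing `Smallest` by the sets with property `P` takes the place of the well-ordering of the
  -- cardinals.
  minimum-exists : {A : Set} (P : Pred (𝒫 A) 0ℓ) → ∃ P →
                   ∃ λ S → P S × (∀ S′ → P S′ → ∣ S ∣ ≤ᶜ ∣ S′ ∣)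
  minimum-exists P ex with Smallest.smallest (λ (S : ∃ P) → ∣ proj₁ S ∣) ex
  ... | (S , PS) , least = S , PS , λ S′ PS′ → least (S′ , PS′)

  -- One reduction yields a `Q`-set of size at most that of `S`, the other shows that every `Q`-set
  -- is at least as large; Cantor-Bernstein turns this into a bijection.
  IsMinCard-transfer : {A B : Set} {P : Pred (𝒫 A) 0ℓ} {Q : Pred (𝒫 B) 0ℓ} →
                       P ⊑ Q → Q ⊑ P → ∀ S → P S → (∀ S′ → P S′ → ∣ S ∣ ≤ᶜ ∣ S′ ∣) →
                       IsMinCard Q ∣ S ∣
  IsMinCard-transfer {Q = Q} P⊑Q Q⊑P S PS S-least =
    let S′ , QS′ , S′≤S = P⊑Q S PS in record
    { attained = S′ , QS′ , cantor-bernstein S′≤S (least S′ QS′)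
    ; least    = least
    }
    where
    least : ∀ S′ → Q S′ → ∣ S ∣ ≤ᶜ ∣ S′ ∣
    least S′ QS′ =
      let S″ , PS″ , S″≤S′ = Q⊑P S′ QS′ in S″≤S′ ↣-∘ S-least S″ PS″

  -- Finite sets of natural numbers

  Small : 𝒫 ℕ → ℕ → Set
  Small S m = ∣ S ∣ ≤ᶜ Fin m

  Small-weaken : ∀ {S m n} → m ≤ n → Small S m → Small S n
  Small-weaken m≤n small = mk↣ (λ {i} {j} → inject≤-injective m≤n m≤n i j) ↣-∘ small

  Small-∅ : ∀ {m} → Small ∅ m
  Small-∅ = mk↣ {to = λ { (_ , ()) }} λ { {_ , ()} }

  singleton : ℕ → 𝒫 ℕ
  singleton x = ⟦ (_≡ x) ⟧

  Small-singleton : ∀ x → Small (singleton x) 1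
  Small-singleton x = mk↣ {to = λ _ → zero} λ {(y , p)} {(z , q)} _ →
    ∣∣-≡ (trans (∈⟦⟧⁻ (_≡ x) p) (sym (∈⟦⟧⁻ (_≡ x) q)))

  ⋃ᶠ : ∀ {N} → (Fin N → 𝒫 ℕ) → 𝒫 ℕ
  ⋃ᶠ S = ⟦ (λ x → ∃ λ c → x ∈ S c) ⟧

  Small-⋃ᶠ : ∀ {N k} (S : Fin N → 𝒫 ℕ) → (∀ c → Small (S c) k) → Small (⋃ᶠ S) (N * k)
  Small-⋃ᶠ {N} {k} S small = mk↣ {to = λ (x , p) → index (∈⟦⟧⁻ (λ x → ∃ λ c → x ∈ S c) p)}
      λ {(x , p)} {(y , q)} eq → ∣∣-≡ (index-injective (∈⟦⟧⁻ _ p) (∈⟦⟧⁻ _ q) eq)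
    where
    index : ∀ {x} → (∃ λ c → x ∈ S c) → Fin (N * k)
    index (c , x∈) = combine c (Injection.to (small c) (_ , x∈))

    index-injective : ∀ {x y} (p : ∃ λ c → x ∈ S c) (q : ∃ λ c → y ∈ S c) →
                      index p ≡ index q → x ≡ y
    index-injective (c , x∈) (d , y∈) eq with combine-injective c _ d _ eq
    ... | refl , eq′ = cong proj₁ (Injection.injective (small c) eq′)

  -- Pigeonhole on the `n + 1` numbers from 0 to `n`.
  Small-avoid : ∀ {S n} → Small S n → ∃ λ x → x ≤ n × x ∉ S
  Small-avoid {S} {n} small = byContradiction λ none →
    let member : (i : Fin (suc n)) → toℕ i ∈ S
        member i = byContradiction λ i∉ → none (toℕ i , ≤-pred (toℕ<n i) , i∉)
    in n≮n n (injective⇒≤ {f = λ i → Injection.to small (toℕ i , member i)}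
         λ eq → toℕ-injective (cong proj₁ (Injection.injective small eq)))

  id→∞ : TendsTo∞ id
  id→∞ k = k , λ _ → id

  -- All functions below the identity: a slalom of width `n` leaves one of the values up to `n`
  -- free.
  𝔣₁-family-exists : ∃ 𝔣₁-family
  𝔣₁-family-exists = ⟦ Below ⟧ , (id , λ h h∈ → 0 , λ n _ → ∈⟦⟧⁻ Below h∈ n) , id , id→∞ ,
      λ X X-inf s → let avoid = λ n → Small-avoid (proj₂ (s n)) in
        (λ n → proj₁ (avoid n)) , ∈⟦⟧⁺ Below (λ n → proj₁ (proj₂ (avoid n))) ,
        λ m → let n , m≤n , n∈X = X-inf m in n , m≤n , n∈X , proj₂ (proj₂ (avoid n))
    where
    Below : Pred (ℕ → ℕ) 0ℓ
    Below h = ∀ n → h n ≤ n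

  -- Slaloms and predictors

  -- Width zero leaves no room for the predicted value; as `g` tends to infinity, this affects
  -- finitely many `n` only.
  [_]-if : ∀ k → ℕ → [ω]^≤ k
  [ zero  ]-if x = ∅ , Small-∅
  [ suc k ]-if x = singleton x , Small-weaken (s≤s z≤n) (Small-singleton x)

  ∈-[]-if : ∀ {k} → 1 ≤ k → ∀ x → x ∈ proj₁ ([ k ]-if x)
  ∈-[]-if (s≤s _) x = ∈⟦⟧⁺ (_≡ x) refl

  𝔣₂⊑𝔢ubd : 𝔣₂-family ⊑ 𝔢ubd-family
  𝔣₂⊑𝔢ubd 𝓗 (bounded , g , g→∞ , evades) = 𝓗 , (bounded , evades′) , ↣-id _
    where
    m₁ = proj₁ (g→∞ 1)

    evades′ : ∀ X → Infinite X → (π : ∀ n → Vec ℕ n → ℕ) →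
              ∃ λ h → h ∈ 𝓗 × ∃∞ λ n → n ∈ X × h n ≢ π n (h ↾ n)
    evades′ X X-inf π with evades X X-inf (λ n σ → [ g n ]-if (π n σ))
    ... | h , h∈𝓗 , escapes = h , h∈𝓗 , λ m →
      let n , m⊔m₁≤n , n∈X , hn∉ = escapes (m ⊔ m₁) in
      n , ≤-trans (m≤m⊔n m m₁) m⊔m₁≤n , n∈X , λ hn≡ →
        hn∉ (subst (λ x → x ∈ proj₁ ([ g n ]-if (π n (h ↾ n)))) (sym hn≡)
               (∈-[]-if (proj₂ (g→∞ 1) n (≤-trans (m≤n⊔m m m₁) m⊔m₁≤n)) _))

  -- Along a sparse sequence e the values of h at earlier points of e admit so
  -- few possibilities that all predictions at e k fit together in one slalom.
  module Sparse (b g : ℕ → ℕ) (g→∞ : TendsTo∞ g) where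

    -- `c` bounds the code of the past, so there are at most `suc c` pasts with at most `k`
    -- predictions each. The maximum with `k` makes `e` unbounded.
    e-from : ℕ → ℕ → ℕ
    e-from k c = proj₁ (g→∞ (suc c * k)) ⊔ k

    histories : ℕ → ℕ
    histories zero    = 0
    histories (suc k) = pair (b (e-from k (histories k))) (histories k)

    e : ℕ → ℕ
    e k = e-from k (histories k)

    k≤e : ∀ k → k ≤ e k
    k≤e k = m≤n⊔m _ k

    e-large : ∀ k → suc (histories k) * k ≤ g (e k)
    e-large k = proj₂ (g→∞ (suc (histories k) * k)) (e k) (m≤m⊔n _ k)

    histories≡ : ∀ k → histories k ≡ code (b ∘ e) k
    histories≡ zero    = refl
    histories≡ (suc k) = cong (pair (b (e k))) (histories≡ k)

    -- `h` lies below `b` only from some point on; capping makes the bound on the codes hold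
    -- everywhere.
    thin : (ℕ → ℕ) → ℕ → ℕ
    thin h k = h (e k) ⊓ b (e k)

    code-thin : ∀ h k → code (thin h) k < suc (histories k)
    code-thin h k = s≤s (subst (code (thin h) k ≤_) (sym (histories≡ k))
                          (code-mono k (λ i → m⊓n≤n (h (e i)) (b (e i)))))

    module _ (X : 𝒫 ℕ) (X-inf : Infinite X) (π : ∀ k → Vec ℕ k → [ω]^≤ k) where

      decode : ℕ → ℕ → ℕ → ℕ
      decode k c = ε (λ f → code f k ≡ c) (λ _ → 0)

      predictions : ∀ k → Fin (suc (histories k)) → 𝒫 ℕ
      predictions k c = proj₁ (π k (decode k (toℕ c) ↾ k))

      merged : ℕ → 𝒫 ℕ
      merged k = ⋃ᶠ (predictions k)

      merged-small : ∀ k → Small (merged k) (g (e k))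
      merged-small k = Small-weaken (e-large k)
        (Small-⋃ᶠ (predictions k) (λ c → proj₂ (π k (decode k (toℕ c) ↾ k))))

      ∈-merged : ∀ h k → thin h k ∈ proj₁ (π k (thin h ↾ k)) → thin h k ∈ merged k
      ∈-merged h k x∈ = ∈⟦⟧⁺ _ (c , subst (λ σ → thin h k ∈ proj₁ (π k σ)) (sym same) x∈)
        where
        c = fromℕ< (code-thin h k)

        same : decode k (toℕ c) ↾ k ≡ thin h ↾ k
        same = ↾-cong k (code-injective (decode k (toℕ c)) (thin h) k
          (trans (ε-satisfies (λ f → code f k ≡ toℕ c) (λ _ → 0)
                              (thin h , sym (toℕ-fromℕ< (code-thin h k))))
                 (toℕ-fromℕ< (code-thin h k))))

      FromX : ℕ → Set
      FromX n = ∃ λ k → k ∈ X × e k ≡ n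

      slalom′ : ∀ n → Dec (FromX n) → [ω]^≤ (g n)
      slalom′ n (yes (k , _ , refl)) = merged k , merged-small k
      slalom′ n (no _)               = ∅ , Small-∅

      slalom : ∀ n → [ω]^≤ (g n)
      slalom n = slalom′ n lem

      -- Several indices may share the value `n` of `e`; an escape at `n` is reported at the one
      -- that the slalom was built for.
      slalom′-escape : ∀ {n x} d → FromX n → x ∉ proj₁ (slalom′ n d) →
                       ∃ λ k → k ∈ X × e k ≡ n × x ∉ merged k
      slalom′-escape (yes (k , k∈X , refl)) _    x∉ = k , k∈X , refl , x∉
      slalom′-escape (no ¬from)             from _  = contradiction from ¬from

      e[X] : 𝒫 ℕ
      e[X] = ⟦ FromX ⟧

      e[X]-infinite : Infinite e[X]
      e[X]-infinite m = let k , m≤k , k∈X = X-inf m in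
        e k , ≤-trans m≤k (k≤e k) , ∈⟦⟧⁺ FromX (k , k∈X , refl)

      thin-escapes : ∀ h → (∀∞ λ n → h n ≤ b n) →
                     (∃∞ λ n → n ∈ e[X] × h n ∉ proj₁ (slalom n)) →
                     ∃∞ λ k → k ∈ X × thin h k ∉ proj₁ (π k (thin h ↾ k))
      thin-escapes h (m₁ , h≤b) escapes m with bounded-below e m
      ... | K , late with escapes (K ⊔ m₁)
      ... | n , le , n∈ , hn∉ with slalom′-escape lem (∈⟦⟧⁻ FromX n∈) hn∉
      ... | k , k∈X , refl , hek∉ =
        k , late k (≤-trans (m≤m⊔n K m₁) le) , k∈X , λ predicted →
          hek∉ (subst (_∈ merged k) (m≤n⇒m⊓n≡m (h≤b (e k) (≤-trans (m≤n⊔m K m₁) le)))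
                  (∈-merged h k predicted))

  𝔣₁⊑𝔣₂ : 𝔣₁-family ⊑ 𝔣₂-family
  𝔣₁⊑𝔣₂ 𝓗 ((b , 𝓗≤b) , g , g→∞ , evades) =
      image thin 𝓗 , ((b ∘ e , bounded) , id , id→∞ , evades′) , ∣image∣≤ thin 𝓗
    where
    open Sparse b g g→∞

    bounded : ∀ h → h ∈ image thin 𝓗 → ∀∞ λ n → h n ≤ b (e n)
    bounded h h∈ with ∈-image⁻ thin 𝓗 h∈
    ... | h₀ , _ , refl = 0 , λ n _ → m⊓n≤n (h₀ (e n)) (b (e n))

    evades′ : ∀ X → Infinite X → (π : ∀ n → Vec ℕ n → [ω]^≤ n) →
              ∃ λ h → h ∈ image thin 𝓗 × ∃∞ λ n → n ∈ X × h n ∉ proj₁ (π n (h ↾ n))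
    evades′ X X-inf π =
      let h , h∈𝓗 , escapes = evades (e[X] X X-inf π) (e[X]-infinite X X-inf π) (slalom X X-inf π)
      in thin h , ∈-image⁺ thin 𝓗 h∈𝓗 , thin-escapes X X-inf π h (𝓗≤b h h∈𝓗) escapes

  -- Levels at which few candidates do not branch

  NonBranching : Pred (ℕ → ℕ) 0ℓ → ℕ → Set
  NonBranching Q n = ∀ f f′ → Q f → Q f′ → (∀ i → i < n → f i ≡ f′ i) → f n ≡ f′ n

  -- Identifying the indices of f₀ and f₁, which branch at level n, saves one index
  -- and still separates the restrictions to n.
  module Merge {Q : Pred (ℕ → ℕ) 0ℓ} {j n : ℕ} (φ : ∀ f → Q f → Fin (suc j))
    (separates : ∀ f f′ q q′ → φ f q ≡ φ f′ q′ → ∀ i → i < suc n → f i ≡ f′ i)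
    {f₀ f₁ : ℕ → ℕ} (q₀ : Q f₀) (q₁ : Q f₁)
    (agree : ∀ i → i < n → f₀ i ≡ f₁ i) (differ : f₀ n ≢ f₁ n) where

    φ₁≢φ₀ : φ f₁ q₁ ≢ φ f₀ q₀
    φ₁≢φ₀ eq = differ (separates f₀ f₁ q₀ q₁ (sym eq) n (n<1+n n))

    merge : ∀ {c} → Dec (φ f₁ q₁ ≡ c) → Fin j
    merge (yes _)   = punchOut φ₁≢φ₀
    merge (no φ₁≢c) = punchOut φ₁≢c

    merge-separates : ∀ f f′ q q′ (d : Dec (φ f₁ q₁ ≡ φ f q)) (d′ : Dec (φ f₁ q₁ ≡ φ f′ q′)) →
                      merge d ≡ merge d′ → ∀ i → i < n → f i ≡ f′ i
    merge-separates f f′ q q′ (yes eq) (yes eq′) _ i i<n =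
      separates f f′ q q′ (trans (sym eq) eq′) i (m<n⇒m<1+n i<n)
    merge-separates f f′ q q′ (no ne) (no ne′) eq i i<n =
      separates f f′ q q′ (punchOut-injective ne ne′ eq) i (m<n⇒m<1+n i<n)
    -- `f` had the index of `f₁`, now replaced by that of `f₀`: below `n`, pass from `f` to `f₁`,
    -- then to `f₀`, then to `f′`.
    merge-separates f f′ q q′ (yes eq₁) (no ne) eq i i<n = trans
      (sym (separates f₁ f q₁ q eq₁ i (m<n⇒m<1+n i<n)))
      (trans (sym (agree i i<n))
        (separates f₀ f′ q₀ q′ (punchOut-injective φ₁≢φ₀ ne eq) i (m<n⇒m<1+n i<n)))
    merge-separates f f′ q q′ (no ne) (yes eq₁) eq i i<n =
      sym (merge-separates f′ f q′ q (yes eq₁) (no ne) (sym eq) i i<n)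

  -- Search downwards from level `a + j`: each branching uses up one index, and when none is left
  -- `Q` is empty.
  nonBranching-level : ∀ {Q : Pred (ℕ → ℕ) 0ℓ} j a (φ : ∀ f → Q f → Fin j) →
    (∀ f f′ q q′ → φ f q ≡ φ f′ q′ → ∀ i → i < suc (a + j) → f i ≡ f′ i) →
    ∃ λ n → a ≤ n × n ≤ a + j × NonBranching Q n
  nonBranching-level zero a φ _ =
    a , ≤-refl , m≤m+n a 0 , λ f f′ q _ _ → case φ f q of λ ()
  nonBranching-level {Q} (suc j) a φ separates
    with lem {P = ∃ λ f → ∃ λ f′ → Q f × Q f′ ×
                  (∀ i → i < a + suc j → f i ≡ f′ i) × f (a + suc j) ≢ f′ (a + suc j)}
  ... | no ¬branch = a + suc j , m≤m+n a (suc j) , ≤-refl , λ f f′ q q′ agree →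
    byContradiction λ differ → ¬branch (f , f′ , q , q′ , agree , differ)
  ... | yes (f₀ , f₁ , q₀ , q₁ , agree , differ) =
    let n , a≤n , n≤a+j , nb = nonBranching-level j a (λ f q → merge (φ f₁ q₁ ≟ φ f q))
          λ f f′ q q′ eq i i< → merge-separates f f′ q q′ (φ f₁ q₁ ≟ φ f q) (φ f₁ q₁ ≟ φ f′ q′) eq i
            (subst (i <_) (sym (+-suc a j)) i<)
    in n , a≤n , ≤-trans n≤a+j (+-monoʳ-≤ a (n≤1+n j)) , nb
    where open Merge φ separates q₀ q₁ agree differ

  module Prefixes (b : ℕ → ℕ) where

    -- Long enough to see the values at all the levels from `k` to `k + k`.
    len : ℕ → ℕ
    len k = k + suc k

    cap : (ℕ → ℕ) → ℕ → ℕ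
    cap h i = h i ⊓ b i

    prefixes : (ℕ → ℕ) → ℕ → ℕ
    prefixes h k = code (cap h) (len k)

    module _ (X : 𝒫 ℕ) (X-inf : Infinite X) (s : ∀ k → [ω]^≤ k) where

      Q : ℕ → Pred (ℕ → ℕ) 0ℓ
      Q k f = code f (len k) ∈ proj₁ (s k)

      level-exists : ∀ k → ∃ λ n → k ≤ n × n ≤ k + k × NonBranching (Q k) n
      level-exists k = nonBranching-level k k (λ f q → Injection.to (proj₂ (s k)) (_ , q))
        λ f f′ q q′ eq i i< →
          code-injective f f′ (len k) (cong proj₁ (Injection.injective (proj₂ (s k)) eq)) i
            (subst (i <_) (sym (+-suc k k)) i<)

      level : ℕ → ℕ
      level k = proj₁ (level-exists k)

      k≤level : ∀ k → k ≤ level k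
      k≤level k = proj₁ (proj₂ (level-exists k))

      level≤ : ∀ k → level k ≤ k + k
      level≤ k = proj₁ (proj₂ (proj₂ (level-exists k)))

      level-nonBranching : ∀ k → NonBranching (Q k) (level k)
      level-nonBranching k = proj₂ (proj₂ (proj₂ (level-exists k)))

      late : ∀ {m} k → len m ≤ level k → m ≤ k
      late {m} k le = ≮⇒≥ λ k<m →
        n≮n (m + m) (≤-trans (≤-reflexive (sym (+-suc m m))) (≤-trans le (≤-trans (level≤ k) (+-mono-≤ (<⇒≤ k<m) (<⇒≤ k<m)))))

      LevelOf : ℕ → Pred ℕ 0ℓ
      LevelOf n k = k ∈ X × level k ≡ n

      levels : 𝒫 ℕ
      levels = ⟦ (λ n → ∃ (LevelOf n)) ⟧

      levels-infinite : Infinite levels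
      levels-infinite m = let k , m≤k , k∈X = X-inf m in
        level k , ≤-trans m≤k (k≤level k) , ∈⟦⟧⁺ _ (k , k∈X , refl)

      -- `level` may take the value `n` at several `k`; the predictor at `n` serves the one chosen
      -- here.
      index : ℕ → ℕ
      index n = ε (LevelOf n) 0

      -- The predictor sees the restriction of h rather than that of cap h, so
      -- it also guesses a function u with that restriction.
      Guess : ∀ n → Vec ℕ n → Pred ((ℕ → ℕ) × (ℕ → ℕ)) 0ℓ
      Guess n σ (f , u) = Q (index n) f × u ↾ n ≡ σ × (∀ i → i < n → f i ≡ cap u i)

      guess : ∀ n → Vec ℕ n → (ℕ → ℕ) × (ℕ → ℕ)
      guess n σ = ε (Guess n σ) ((λ _ → 0) , (λ _ → 0))

      predictor : ∀ n → Vec ℕ n → ℕ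
      predictor n σ = proj₁ (guess n σ) n

      -- The guessed function and `cap h` are both candidates and agree below `n`, a level without
      -- branching.
      predicts : ∀ h n → n ∈ levels → Q (index n) (cap h) → predictor n (h ↾ n) ≡ cap h n
      predicts h n n∈ q with ε-satisfies (LevelOf n) 0 (∈⟦⟧⁻ _ n∈)
                           | ε-satisfies (Guess n (h ↾ n)) ((λ _ → 0) , (λ _ → 0))
                                         -- The pair `(cap h , h)` shows that a guess exists.
                                         ((cap h , h) , q , refl , λ _ _ → refl)
      ... | _ , level≡n | qf , u↾n≡ , f≡cap =
        subst (NonBranching (Q (index n))) level≡n (level-nonBranching (index n))
          (proj₁ (guess n (h ↾ n))) (cap h) qf q
          λ i i<n → trans (f≡cap i i<n) (cong (_⊓ b i) (↾-injective _ h n u↾n≡ i i<n))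

      prefixes-escape : ∀ h → (∀∞ λ n → h n ≤ b n) →
                        (∃∞ λ n → n ∈ levels × h n ≢ predictor n (h ↾ n)) →
                        ∃∞ λ k → k ∈ X × prefixes h k ∉ proj₁ (s k)
      prefixes-escape h (m₁ , h≤b) escapes m with escapes (len m ⊔ m₁)
      ... | n , le , n∈ , hn≢ with ε-satisfies (LevelOf n) 0 (∈⟦⟧⁻ _ n∈)
      ... | k∈X , level≡n = index n ,
        late (index n) (subst (len m ≤_) (sym level≡n) (≤-trans (m≤m⊔n (len m) m₁) le)) ,
        k∈X , λ q → hn≢ (sym (trans (predicts h n n∈ q)
                               (m≤n⇒m⊓n≡m (h≤b n (≤-trans (m≤n⊔m (len m) m₁) le)))))

  𝔢ubd⊑𝔣₁ : 𝔢ubd-family ⊑ 𝔣₁-family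
  𝔢ubd⊑𝔣₁ 𝓗 ((b , 𝓗≤b) , evades) =
      image prefixes 𝓗 , (((λ k → code b (len k)) , bounded) , id , id→∞ , evades′) ,
      ∣image∣≤ prefixes 𝓗
    where
    open Prefixes b

    bounded : ∀ h → h ∈ image prefixes 𝓗 → ∀∞ λ k → h k ≤ code b (len k)
    bounded h h∈ with ∈-image⁻ prefixes 𝓗 h∈
    ... | h₀ , _ , refl = 0 , λ k _ → code-mono (len k) (λ i → m⊓n≤n (h₀ i) (b i))

    evades′ : ∀ X → Infinite X → (s : ∀ n → [ω]^≤ n) →
              ∃ λ h → h ∈ image prefixes 𝓗 × ∃∞ λ n → n ∈ X × h n ∉ proj₁ (s n)
    evades′ X X-inf s =
      let h , h∈𝓗 , escapes = evades (levels X X-inf s) (levels-infinite X X-inf s) (predictor X X-inf s)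
      in prefixes h , ∈-image⁺ prefixes 𝓗 h∈𝓗 , prefixes-escape X X-inf s h (𝓗≤b h h∈𝓗) escapes

  -- Compactness of the Cantor space

  Agree : ℕ → 𝒫 ℕ → 𝒫 ℕ → Set
  Agree N X Y = ∀ i → i < N → X i ≡ Y i

  module Limit (f : ℕ → 𝒫 ℕ) where

    -- The Bolzano-Weierstrass choice: for infinite `Q`, a bit at `j` shared by infinitely many
    -- terms with index in `Q`, with preference for `true`.
    next-value : Pred ℕ 0ℓ → ℕ → Bool
    next-value Q j = ⟦ (λ j → ∃∞ λ M → Q M × f M j ≡ true) ⟧ j

    Remaining : ℕ → Pred ℕ 0ℓ
    Remaining zero    M = ⊤
    Remaining (suc j) M = Remaining j M × f M j ≡ next-value (Remaining j) j

    limit : 𝒫 ℕ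
    limit j = next-value (Remaining j) j

    refine-infinite : ∀ Q j → ∃∞ Q → ∃∞ λ M → Q M × f M j ≡ next-value Q j
    refine-infinite Q j inf with next-value Q j in eq
    ... | true  = ∈⟦⟧⁻ (λ j → ∃∞ λ M → Q M × f M j ≡ true) (Equivalence.from T-≡ eq)
    ... | false with ¬∃∞⇒∀∞¬ {P = λ M → Q M × f M j ≡ true} (λ inf-true →
                  subst T eq (∈⟦⟧⁺ (λ j → ∃∞ λ M → Q M × f M j ≡ true) inf-true))
    ...   | m₁ , false-from = λ m →
      let M , le , qM = inf (m ⊔ m₁) in
      M , ≤-trans (m≤m⊔n m m₁) le , qM ,
      ≢true⇒≡false (λ eq′ → false-from M (≤-trans (m≤n⊔m m m₁) le) (qM , eq′))
      where
      ≢true⇒≡false : ∀ {x} → x ≢ true → x ≡ false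
      ≢true⇒≡false {true}  ne = contradiction refl ne
      ≢true⇒≡false {false} _  = refl

    remaining-infinite : ∀ N → ∃∞ (Remaining N)
    remaining-infinite zero    m = m , ≤-refl , tt
    remaining-infinite (suc N) = refine-infinite (Remaining N) N (remaining-infinite N)

    remaining-agree : ∀ N {M} → Remaining N M → Agree N (f M) limit
    remaining-agree (suc N) (rem , eq) i i<1+N with m≤n⇒m<n∨m≡n (≤-pred i<1+N)
    ... | inj₁ i<N  = remaining-agree N rem i i<N
    ... | inj₂ refl = eq

    converges : ∀ N → ∃∞ λ M → Agree N (f M) limit
    converges N m = map₂ (map₂ (remaining-agree N)) (remaining-infinite N m)

  SeqClosed : Pred (𝒫 ℕ) 0ℓ → Set
  SeqClosed P = ∀ Y → (∀ N → ∃ λ X → P X × Agree N X Y) → P Y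

  closed⇒seqClosed : ∀ 𝓒 → IsClosed 𝓒 → SeqClosed (_∈ 𝓒)
  closed⇒seqClosed 𝓒 closed Y approx = byContradiction λ Y∉ →
    let is , nbhd = closed Y (∉⇒∈∁ 𝓒 Y∉)
        N , is<N  = list-bound is
        X , X∈ , X≈Y = approx N
    in ∈∁⇒∉ 𝓒 (nbhd X (All.map (λ {i} → X≈Y i) is<N)) X∈

  -- If `Y` had neither property, approximation by each would fail at some length; an approximant at
  -- the larger length has one of them.
  seqClosed-⊎ : ∀ {P Q} → SeqClosed P → SeqClosed Q → SeqClosed (λ X → P X ⊎ Q X)
  seqClosed-⊎ {P} {Q} closedP closedQ Y approx = byContradiction λ ¬PQ →
    let N₁ , noP = ¬∀⇒∃¬ (¬PQ ∘ inj₁ ∘ closedP Y)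
        N₂ , noQ = ¬∀⇒∃¬ (¬PQ ∘ inj₂ ∘ closedQ Y)
        X , PQX , X≈Y = approx (N₁ ⊔ N₂)
    in [ (λ p → noP (X , p , λ i i< → X≈Y i (≤-trans i< (m≤m⊔n N₁ N₂))))
       , (λ q → noQ (X , q , λ i i< → X≈Y i (≤-trans i< (m≤n⊔m N₁ N₂)))) ]′ PQX

  -- One set codes a sequence of sets, so `Limit` also gives compactness for tuples.
  slice : 𝒫 ℕ → ℕ → 𝒫 ℕ
  slice Z i x = Z (pair i x)

  join : (ℕ → 𝒫 ℕ) → 𝒫 ℕ
  join Y = ⟦ (λ p → ∃ λ i → ∃ λ x → p ≡ pair i x × x ∈ Y i) ⟧

  slice-join : ∀ Y i → slice (join Y) i ≡ Y i
  slice-join Y i = 𝒫-ext classical _ _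
    (λ x x∈ → let i′ , x′ , eq , x′∈ = ∈⟦⟧⁻ _ x∈
                  i≡i′ , x≡x′ = pair-injective i x i′ x′ eq
              in subst (λ i → x ∈ Y i) (sym i≡i′) (subst (_∈ Y i′) (sym x≡x′) x′∈))
    (λ x x∈ → ∈⟦⟧⁺ _ (i , x , refl , x∈))

  ⋂ : ℕ → (ℕ → 𝒫 ℕ) → 𝒫 ℕ
  ⋂ zero    Y = full
  ⋂ (suc n) Y = ⋂ n Y ∩ Y n

  ∈-⋂⁻ : ∀ n Y {x} → x ∈ ⋂ n Y → ∀ i → i < n → x ∈ Y i
  ∈-⋂⁻ (suc n) Y x∈ i i<1+n with ∈-∩⁻ (⋂ n Y) (Y n) x∈ | m≤n⇒m<n∨m≡n (≤-pred i<1+n)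
  ... | x∈⋂ , _    | inj₁ i<n  = ∈-⋂⁻ n Y x∈⋂ i i<n
  ... | _   , x∈Yn | inj₂ refl = x∈Yn

  full∈ : ∀ 𝓕 → IsFilter 𝓕 → full ∈ 𝓕
  full∈ 𝓕 isFilter = IsFilter.cofinite isFilter full (0 , λ _ _ ())

  ⋂∈ : ∀ 𝓕 → IsFilter 𝓕 → ∀ n Y → (∀ i → i < n → Y i ∈ 𝓕) → ⋂ n Y ∈ 𝓕
  ⋂∈ 𝓕 isFilter zero    Y _  = full∈ 𝓕 isFilter
  ⋂∈ 𝓕 isFilter (suc n) Y Y∈ = IsFilter.∩-closed isFilter _ _
    (⋂∈ 𝓕 isFilter n Y (λ i i<n → Y∈ i (m<n⇒m<1+n i<n))) (Y∈ n (n<1+n n))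

  -- From an Fσ filter to slaloms

  module FσFilter (𝓖 : 𝒫 (𝒫 ℕ)) (isFilter : IsFilter 𝓖) (isFσ : IsFσ 𝓖) where

    𝓒 : ℕ → 𝒫 (𝒫 ℕ)
    𝓒 = proj₁ isFσ

    -- Finite unions make the closed pieces increasing.
    Among : ℕ → Pred (𝒫 ℕ) 0ℓ
    Among zero    X = X ∈ 𝓒 0
    Among (suc K) X = Among K X ⊎ X ∈ 𝓒 (suc K)

    𝓒⇒among : ∀ {k X} K → k ≤ K → X ∈ 𝓒 k → Among K X
    𝓒⇒among zero    z≤n  X∈ = X∈
    𝓒⇒among (suc K) k≤1+K X∈ with m≤n⇒m<n∨m≡n k≤1+K
    ... | inj₁ k<1+K = inj₁ (𝓒⇒among K (≤-pred k<1+K) X∈)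
    ... | inj₂ refl  = inj₂ X∈

    among⇒𝓖 : ∀ K {X} → Among K X → X ∈ 𝓖
    among⇒𝓖 zero    {X} p        = Equivalence.from (proj₂ (proj₂ isFσ) X) (0 , p)
    among⇒𝓖 (suc K)     (inj₁ p) = among⇒𝓖 K p
    among⇒𝓖 (suc K) {X} (inj₂ p) = Equivalence.from (proj₂ (proj₂ isFσ) X) (suc K , p)

    among-closed : ∀ K → SeqClosed (Among K)
    among-closed zero    = closed⇒seqClosed (𝓒 0) (proj₁ (proj₂ isFσ) 0)
    among-closed (suc K) = seqClosed-⊎ (among-closed K)
      (closed⇒seqClosed (𝓒 (suc K)) (proj₁ (proj₂ isFσ) (suc K)))

    Valid : ℕ → ℕ → Pred (𝒫 ℕ) 0ℓ
    Valid K n Z = ∀ i → i < n → Among K (slice Z i)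

    Hit : ℕ → ℕ → ℕ → Pred (𝒫 ℕ) 0ℓ
    Hit n m M Z = ∃ λ x → m ≤ x × x < M × (∀ i → i < n → x ∈ slice Z i)

    abstract
      -- Otherwise the counterexamples for all `M` accumulate at a tuple from the same closed
      -- pieces. Its intersection lies in the filter, hence has an element `x` beyond `m`, and a
      -- late counterexample close to the limit is hit at `x`.
      uniform-hit : ∀ K n m → ∃ λ M → ∀ Z → Valid K n Z → Hit n m M Z
      uniform-hit K n m = byContradiction λ none →
        let counterexample : ∀ M → ∃ λ Z → Valid K n Z × ¬ Hit n m M Z
            counterexample M = byContradiction λ ¬ex → none (M , λ Z valid →
              byContradiction λ ¬hit → ¬ex (Z , valid , ¬hit))
            f = proj₁ ∘ counterexample
            open Limit f
            limit-valid : Valid K n limit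
            limit-valid i i<n = among-closed K (slice limit i) λ N →
              -- This length covers the coordinates `pair i x` for all `x < N`.
              let M , _ , agree = converges (suc (pair i N)) 0 in
              slice (f M) i , proj₁ (proj₂ (counterexample M)) i i<n ,
              λ x x<N → agree (pair i x) (s≤s (pair-mono (≤-refl {i}) (<⇒≤ x<N)))
            x , m≤x , x∈ = IsFilter.proper isFilter (⋂ n (slice limit))
              (⋂∈ 𝓖 isFilter n (slice limit) (λ i i<n → among⇒𝓖 K (limit-valid i i<n))) m
            -- The counterexample index is taken beyond `x`, so that `x` falls below `M`.
            M , x<M , agree = converges (suc (pair n x)) (suc x)
        in proj₂ (proj₂ (counterexample M)) (x , m≤x , x<M , λ i i<n →
             subst T (sym (agree (pair i x) (s≤s (pair-mono (<⇒≤ i<n) (≤-refl {x})))))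
               (∈-⋂⁻ n (slice limit) x∈ i i<n))

    -- A piece containing `full`. Starting from it makes `full` an admissible default candidate at
    -- every `n`.
    k₀ : ℕ
    k₀ = proj₁ (Equivalence.to (proj₂ (proj₂ isFσ) full) (full∈ 𝓖 isFilter))

    full-among : ∀ n → Among (k₀ + n) full
    full-among n = 𝓒⇒among (k₀ + n) (m≤m+n k₀ n)
      (proj₂ (Equivalence.to (proj₂ (proj₂ isFσ) full) (full∈ 𝓖 isFilter)))

    window : ℕ → ℕ
    window n = proj₁ (uniform-hit (k₀ + n) n n)

    trace : 𝒫 ℕ → ℕ → ℕ
    trace X n = codeˢ X (window n)

    module _ (A : 𝒫 ℕ) (A-inf : Infinite A) (s : ∀ n → [ω]^≤ n) where

      Candidate : ℕ → ℕ → Pred (𝒫 ℕ) 0ℓ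
      Candidate n i X = Among (k₀ + n) X ×
        Σ (trace X n ∈ proj₁ (s n)) λ t∈ → toℕ (Injection.to (proj₂ (s n)) (_ , t∈)) ≡ i

      candidate : ℕ → ℕ → 𝒫 ℕ
      candidate n i = ε (Candidate n i) full

      candidate-among : ∀ n i → Among (k₀ + n) (candidate n i)
      candidate-among n i with ε-satisfies-or-default (Candidate n i) full
      ... | inj₁ (among , _) = among
      ... | inj₂ eq          = subst (Among (k₀ + n)) (sym eq) (full-among n)

      hit : ∀ n → Hit n n (window n) (join (candidate n))
      hit n = proj₂ (uniform-hit (k₀ + n) n n) (join (candidate n)) λ i _ →
        subst (Among (k₀ + n)) (sym (slice-join (candidate n) i)) (candidate-among n i)

      point : ℕ → ℕ
      point n = proj₁ (hit n)

      n≤point : ∀ n → n ≤ point n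
      n≤point n = proj₁ (proj₂ (hit n))

      point-∈ : ∀ n i → i < n → point n ∈ candidate n i
      point-∈ n i i<n = subst (point n ∈_) (slice-join (candidate n) i)
        (proj₂ (proj₂ (proj₂ (hit n))) i i<n)

      -- `X` itself shows that a candidate with its trace exists. The chosen one agrees with `X`
      -- below the window bound, and the point lies there.
      point∈X : ∀ n X → Among (k₀ + n) X → trace X n ∈ proj₁ (s n) → point n ∈ X
      point∈X n X among t∈ = subst T
          (codeˢ-injective Y X (window n) same-trace (point n) (proj₁ (proj₂ (proj₂ (hit n)))))
          (point-∈ n i (toℕ<n (Injection.to (proj₂ (s n)) (trace X n , t∈))))
        where
        i = toℕ (Injection.to (proj₂ (s n)) (trace X n , t∈))
        Y = candidate n i
        Y-candidate : Candidate n i Y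
        Y-candidate = ε-satisfies (Candidate n i) full (X , among , t∈ , refl)
        same-trace : trace Y n ≡ trace X n
        same-trace = cong proj₁ (Injection.injective (proj₂ (s n))
          (toℕ-injective (proj₂ (proj₂ Y-candidate))))

      Points : Pred ℕ 0ℓ
      Points x = ∃ λ n → n ∈ A × point n ≡ x

      points : 𝒫 ℕ
      points = ⟦ Points ⟧

      points-infinite : Infinite points
      points-infinite m = let n , m≤n , n∈A = A-inf m in
        point n , ≤-trans m≤n (n≤point n) , ∈⟦⟧⁺ Points (n , n∈A , refl)

      points-⊆* : ∀ X → X ∈ 𝓖 → (∀∞ λ n → ¬ (n ∈ A × trace X n ∉ proj₁ (s n))) → points ⊆* X
      points-⊆* X X∈𝓖 (m , caught) with Equivalence.to (proj₂ (proj₂ isFσ) X) X∈𝓖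
      ... | k , X∈𝓒 with bounded-below point (m ⊔ k)
      ... | K , late = ⊆*⁺ points X (K , λ x K≤x x∈ → member x K≤x (∈⟦⟧⁻ Points x∈))
        where
        member : ∀ x → K ≤ x → Points x → x ∈ X
        member _ K≤x (n , n∈A , refl) =
          let m⊔k≤n = late n K≤x in
          point∈X n X
            (𝓒⇒among (k₀ + n) (≤-trans (m≤n⊔m m k) (≤-trans m⊔k≤n (m≤n+m n k₀))) X∈𝓒)
            (byContradiction λ t∉ → caught n (≤-trans (m≤m⊔n m k) m⊔k≤n) (n∈A , t∉))

  -- Comparison with this filter shows that `P` diagonalizes a generated filter as soon as it is
  -- almost contained in the generators.
  almost-supersets : 𝒫 ℕ → 𝒫 (𝒫 ℕ)
  almost-supersets P = ⟦ P ⊆*_ ⟧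

  almost-supersets-filter : ∀ P → Infinite P → IsFilter (almost-supersets P)
  almost-supersets-filter P P-inf = record
    { ∩-closed = λ X Y X∈ Y∈ →
        let m , P⊆X = ⊆*⁻ P X (∈⟦⟧⁻ _ X∈) ; m′ , P⊆Y = ⊆*⁻ P Y (∈⟦⟧⁻ _ Y∈) in
        ∈⟦⟧⁺ _ (⊆*⁺ P (X ∩ Y) (m ⊔ m′ , λ n le n∈ → ∈-∩⁺ X Y
          (P⊆X n (≤-trans (m≤m⊔n m m′) le) n∈) (P⊆Y n (≤-trans (m≤n⊔m m m′) le) n∈)))
    ; ⊆-closed = λ X Y X∈ X⊆Y →
        let m , P⊆X = ⊆*⁻ P X (∈⟦⟧⁻ _ X∈) in
        ∈⟦⟧⁺ _ (⊆*⁺ P Y (m , λ n le n∈ → X⊆Y n (P⊆X n le n∈)))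
    ; cofinite = λ X (m , fin) → ∈⟦⟧⁺ _ (⊆*⁺ P X (m , λ n le _ → ∉∁⇒∈ X (fin n le)))
    ; proper   = λ X X∈ m →
        let m′ , P⊆X = ⊆*⁻ P X (∈⟦⟧⁻ _ X∈) ; n , le , n∈P = P-inf (m ⊔ m′) in
        n , ≤-trans (m≤m⊔n m m′) le , P⊆X n (≤-trans (m≤n⊔m m m′) le) n∈P
    }

  𝔣⊑𝔣₁ : 𝔣-family ⊑ 𝔣₁-family
  𝔣⊑𝔣₁ 𝓧 (_ , 𝓕 , generates , nonTrivial , 𝓖 , 𝓖-filter , 𝓖-Fσ , 𝓕⊆𝓖) =
      image trace 𝓧 , (((maxCodeˢ ∘ window) , bounded) , id , id→∞ , evades) , ∣image∣≤ trace 𝓧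
    where
    open FσFilter 𝓖 𝓖-filter 𝓖-Fσ

    bounded : ∀ h → h ∈ image trace 𝓧 → ∀∞ λ n → h n ≤ maxCodeˢ (window n)
    bounded h h∈ with ∈-image⁻ trace 𝓧 h∈
    ... | X , _ , refl = 0 , λ n _ → codeˢ≤max X (window n)

    evades : ∀ A → Infinite A → (s : ∀ n → [ω]^≤ n) →
             ∃ λ h → h ∈ image trace 𝓧 × ∃∞ λ n → n ∈ A × h n ∉ proj₁ (s n)
    evades A A-inf s = byContradiction λ none → nonTrivial
      (points A A-inf s , points-infinite A A-inf s , λ Y Y∈𝓕 → ∈⟦⟧⁻ _
        (Generates.smallest generates (almost-supersets (points A A-inf s))
          (almost-supersets-filter _ (points-infinite A A-inf s))
          (λ X X∈𝓧 → ∈⟦⟧⁺ _ (points-⊆* A A-inf s X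
            (𝓕⊆𝓖 X (Generates.contains generates X X∈𝓧))
            (¬∃∞⇒∀∞¬ λ escapes → none (trace X , ∈-image⁺ trace 𝓧 X∈𝓧 , escapes))))
          Y Y∈𝓕))

  -- From slaloms to an Fσ filter

  generated : 𝒫 (𝒫 ℕ) → 𝒫 (𝒫 ℕ)
  generated 𝓧 = ⟦ (λ X → ∀ 𝓖 → IsFilter 𝓖 → 𝓧 ⊆ 𝓖 → X ∈ 𝓖) ⟧

  generated-⊆ : ∀ {𝓧} 𝓖 → IsFilter 𝓖 → 𝓧 ⊆ 𝓖 → generated 𝓧 ⊆ 𝓖
  generated-⊆ 𝓖 isFilter 𝓧⊆𝓖 X X∈ = ∈⟦⟧⁻ _ X∈ 𝓖 isFilter 𝓧⊆𝓖

  -- Properness is inherited from `𝓖`; the other closure properties pass to intersections of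
  -- filters.
  generates : ∀ 𝓧 𝓖 → IsFilter 𝓖 → 𝓧 ⊆ 𝓖 → Generates 𝓧 (generated 𝓧)
  generates 𝓧 𝓖 𝓖-filter 𝓧⊆𝓖 = record
    { isFilter = record
      { ∩-closed = λ X Y X∈ Y∈ → ∈⟦⟧⁺ _ λ 𝓗 fil sub →
          IsFilter.∩-closed fil X Y (∈⟦⟧⁻ _ X∈ 𝓗 fil sub) (∈⟦⟧⁻ _ Y∈ 𝓗 fil sub)
      ; ⊆-closed = λ X Y X∈ X⊆Y → ∈⟦⟧⁺ _ λ 𝓗 fil sub →
          IsFilter.⊆-closed fil X Y (∈⟦⟧⁻ _ X∈ 𝓗 fil sub) X⊆Y
      ; cofinite = λ X cof → ∈⟦⟧⁺ _ λ 𝓗 fil _ → IsFilter.cofinite fil X cof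
      ; proper   = λ X X∈ → IsFilter.proper 𝓖-filter X (generated-⊆ 𝓖 𝓖-filter 𝓧⊆𝓖 X X∈)
      }
    ; contains = λ X X∈ → ∈⟦⟧⁺ _ λ 𝓗 _ sub → sub X X∈
    ; smallest = λ 𝓗 fil sub → generated-⊆ 𝓗 fil sub
    }

  -- The underlying countable set consists of the pairs (n , S) with S a set of
  -- at most g n numbers, coded by enc.  Only the part of S below b n + 1 enters
  -- the code, so that each level n has finitely many codes.
  module SlalomFilter (b g : ℕ → ℕ) (g→∞ : TendsTo∞ g) where

    enc : ℕ → 𝒫 ℕ → ℕ
    enc n S = pair n (codeˢ S (suc (b n)))

    n≤enc : ∀ n S → n ≤ enc n S
    n≤enc n S = ≤-pairˡ n (codeˢ S (suc (b n)))

    max-enc : ℕ → ℕ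
    max-enc n = pair n (maxCodeˢ (suc (b n)))

    enc≤max : ∀ n S → enc n S ≤ max-enc n
    enc≤max n S = pair-mono (≤-refl {n}) (codeˢ≤max S (suc (b n)))

    enc-injective : ∀ n S n′ S′ → enc n S ≡ enc n′ S′ →
                    n ≡ n′ × (∀ i → i ≤ b n → S i ≡ S′ i)
    enc-injective n S n′ S′ eq
      with pair-injective n (codeˢ S (suc (b n))) n′ (codeˢ S′ (suc (b n′))) eq
    ... | refl , same = refl , λ i i≤ → codeˢ-injective S S′ (suc (b n)) same i (s≤s i≤)

    LargeAt : ℕ → ℕ → Pred (𝒫 ℕ) 0ℓ
    LargeAt k n Y = ∃ λ t → Small t k × (∀ S → Small S (g n) → t ⊆ S → enc n S ∈ Y)

    -- One `k` bounds both the size of `t` and the first level, so a single number indexes the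
    -- closed pieces.
    Large : ℕ → Pred (𝒫 ℕ) 0ℓ
    Large k Y = ∀ n → k ≤ n → LargeAt k n Y

    EventuallyLarge : Pred (𝒫 ℕ) 0ℓ
    EventuallyLarge Y = ∃ λ k → Large k Y

    𝓖 : 𝒫 (𝒫 ℕ)
    𝓖 = ⟦ EventuallyLarge ⟧

    both : 𝒫 ℕ → 𝒫 ℕ → Fin 2 → 𝒫 ℕ
    both t t′ zero    = t
    both t t′ (suc _) = t′

    -- Any `S` containing the union of the two small sets contains each of them; the union at most
    -- doubles the size.
    large-∩ : ∀ {k k′ X Y} → Large k X → Large k′ Y → Large (2 * (k ⊔ k′)) (X ∩ Y)
    large-∩ {k} {k′} {X} {Y} LX LY n le =
      let t  , t-small  , tX = LX n (≤-trans (m≤m⊔n k k′) k⊔k′≤n)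
          t′ , t′-small , tY = LY n (≤-trans (m≤n⊔m k k′) k⊔k′≤n)
          small = λ { zero    → Small-weaken (m≤m⊔n k k′) t-small
                    ; (suc _) → Small-weaken (m≤n⊔m k k′) t′-small }
      in ⋃ᶠ (both t t′) , Small-⋃ᶠ (both t t′) small , λ S S-small sub → ∈-∩⁺ X Y
           (tX S S-small (λ x x∈ → sub x (∈⟦⟧⁺ _ (zero , x∈))))
           (tY S S-small (λ x x∈ → sub x (∈⟦⟧⁺ _ (suc zero , x∈))))
      where
      k⊔k′≤n : k ⊔ k′ ≤ n
      k⊔k′≤n = ≤-trans (m≤m+n (k ⊔ k′) _) le

    -- Once `g n` reaches `k`, the set `t` is itself a possible `S`, and its code is at least `n`.
    large-infinite : ∀ {k Y} → Large k Y → Infinite Y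
    large-infinite {k} LY m =
      let m₁ , large = g→∞ k
          n = m ⊔ (k ⊔ m₁)
          k⊔m₁≤n = m≤n⊔m m (k ⊔ m₁)
          t , t-small , tY = LY n (≤-trans (m≤m⊔n k m₁) k⊔m₁≤n)
      in enc n t , ≤-trans (m≤m⊔n m (k ⊔ m₁)) (n≤enc n t) ,
         tY t (Small-weaken (large n (≤-trans (m≤n⊔m k m₁) k⊔m₁≤n)) t-small) (λ _ → id)

    𝓖-filter : IsFilter 𝓖
    𝓖-filter = record
      { ∩-closed = λ X Y X∈ Y∈ →
          let _ , LX = ∈⟦⟧⁻ EventuallyLarge X∈ ; _ , LY = ∈⟦⟧⁻ EventuallyLarge Y∈ in
          ∈⟦⟧⁺ EventuallyLarge (_ , large-∩ {X = X} {Y} LX LY)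
      ; ⊆-closed = λ X Y X∈ X⊆Y → let k , LX = ∈⟦⟧⁻ EventuallyLarge X∈ in ∈⟦⟧⁺ EventuallyLarge (k , λ n k≤n →
          let t , t-small , tX = LX n k≤n in
          t , t-small , λ S S-small t⊆S → X⊆Y _ (tX S S-small t⊆S))
      ; cofinite = λ X (m , fin) → ∈⟦⟧⁺ EventuallyLarge (m , λ n m≤n →
          ∅ , Small-∅ , λ S _ _ → ∉∁⇒∈ X (fin (enc n S) (≤-trans m≤n (n≤enc n S))))
      ; proper = λ X X∈ → let _ , LX = ∈⟦⟧⁻ EventuallyLarge X∈ in large-infinite LX
      }

    -- Failure happens at a single level `n`, where all codes are at most `max-enc n`; fixing those
    -- coordinates preserves it.
    large-closed : ∀ k → IsClosed ⟦ Large k ⟧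
    large-closed k X X∈ =
      let n , notAt   = ¬∀⇒∃¬ (∈∁⇒∉ ⟦ Large k ⟧ X∈ ∘ ∈⟦⟧⁺ (Large k))
          k≤n , ¬large = ¬∀⇒∃¬ notAt
      in upTo (suc (max-enc n)) , λ Y agree → ∉⇒∈∁ ⟦ Large k ⟧ λ Y∈ →
           let t , t-small , tY = ∈⟦⟧⁻ (Large k) Y∈ n k≤n in
           ¬large (t , t-small , λ S S-small t⊆S →
             subst T (All.lookup agree (∈-upTo⁺ (s≤s (enc≤max n S)))) (tY S S-small t⊆S))

    𝓖-Fσ : IsFσ 𝓖
    𝓖-Fσ = (λ k → ⟦ Large k ⟧) , large-closed , λ X → mk⇔
      (λ X∈ → let k , LX = ∈⟦⟧⁻ EventuallyLarge X∈ in k , ∈⟦⟧⁺ (Large k) LX)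
      (λ (k , X∈) → ∈⟦⟧⁺ EventuallyLarge (k , ∈⟦⟧⁻ (Large k) X∈))

    Captures : (ℕ → ℕ) → Pred ℕ 0ℓ
    Captures h p = ∃ λ n → ∃ λ (S : [ω]^≤ (g n)) → h n ∈ proj₁ S × p ≡ enc n (proj₁ S)

    capturing : (ℕ → ℕ) → 𝒫 ℕ
    capturing h = ⟦ Captures h ⟧

    capturing∈𝓖 : ∀ h → capturing h ∈ 𝓖
    capturing∈𝓖 h = ∈⟦⟧⁺ EventuallyLarge (1 , λ n _ → singleton (h n) , Small-singleton (h n) ,
      λ S S-small h∈ → ∈⟦⟧⁺ (Captures h)
        (n , (S , S-small) , h∈ (h n) (∈⟦⟧⁺ (_≡ h n) refl) , refl))

    module _ (A : 𝒫 ℕ) (A-inf : Infinite A) where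

      Choice : ∀ n → Pred ([ω]^≤ (g n)) 0ℓ
      Choice n S = enc n (proj₁ S) ∈ A

      slalom : ∀ n → [ω]^≤ (g n)
      slalom n = ε (Choice n) (∅ , Small-∅)

      met : 𝒫 ℕ
      met = ⟦ (λ n → ∃ (Choice n)) ⟧

      -- Almost all elements of `A` are codes, and large codes belong to large levels because each
      -- level has a largest code.
      met-infinite : ∀ h → A ⊆* capturing h → Infinite met
      met-infinite h A⊆* m with ⊆*⁻ A (capturing h) A⊆* | bounded-below max-enc m
      ... | m₁ , A⊆ | K , late with A-inf (K ⊔ m₁)
      ... | a , le , a∈A with ∈⟦⟧⁻ (Captures h) (A⊆ a (≤-trans (m≤n⊔m K m₁) le) a∈A)
      ... | n , S , _ , refl =
        n , late n (≤-trans (≤-trans (m≤m⊔n K m₁) le) (enc≤max n (proj₁ S))) ,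
        ∈⟦⟧⁺ (λ n → ∃ (Choice n)) (S , a∈A)

      -- The code of the chosen set at a large `n` is in `A`, so it also codes some `S` containing
      -- `h n`; equal codes force agreement up to `b n`, hence at `h n`.
      slalom-captures : ∀ h → (∀∞ λ n → h n ≤ b n) → A ⊆* capturing h →
                        ¬ (∃∞ λ n → n ∈ met × h n ∉ proj₁ (slalom n))
      slalom-captures h (m₁ , h≤b) A⊆* escapes with ⊆*⁻ A (capturing h) A⊆*
      ... | m₂ , A⊆ with escapes (m₁ ⊔ m₂)
      ... | n , le , n∈ , h∉ with ε-satisfies (Choice n) (∅ , Small-∅) (∈⟦⟧⁻ _ n∈)
      ... | a∈A with ∈⟦⟧⁻ (Captures h) (A⊆ _
                       (≤-trans (≤-trans (m≤n⊔m m₁ m₂) le) (n≤enc n (proj₁ (slalom n)))) a∈A)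
      ... | n′ , S , h∈S , eq with enc-injective n (proj₁ (slalom n)) n′ (proj₁ S) eq
      ... | refl , same =
        h∉ (subst T (sym (same (h n) (h≤b n (≤-trans (m≤m⊔n m₁ m₂) le)))) h∈S)

  𝔣₁⊑𝔣 : 𝔣₁-family ⊑ 𝔣-family
  𝔣₁⊑𝔣 𝓗 ((b , 𝓗≤b) , g , g→∞ , evades) =
      𝓧 , ((λ X X∈ → IsFilter.proper 𝓖-filter X (𝓧⊆𝓖 X X∈)) ,
           generated 𝓧 , gen , nonTrivial ,
           𝓖 , 𝓖-filter , 𝓖-Fσ , generated-⊆ 𝓖 𝓖-filter 𝓧⊆𝓖) ,
      ∣image∣≤ capturing 𝓗
    where
    open SlalomFilter b g g→∞

    𝓧 : 𝒫 (𝒫 ℕ)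
    𝓧 = image capturing 𝓗

    𝓧⊆𝓖 : 𝓧 ⊆ 𝓖
    𝓧⊆𝓖 X X∈ with ∈-image⁻ capturing 𝓗 X∈
    ... | h , _ , refl = capturing∈𝓖 h

    gen : Generates 𝓧 (generated 𝓧)
    gen = generates 𝓧 𝓖 𝓖-filter 𝓧⊆𝓖

    nonTrivial : NonTrivial (generated 𝓧)
    nonTrivial (A , A-inf , diagonal) =
        -- Evading the empty slalom yields some member of `𝓗`, from which `met` is seen to be
        -- infinite.
        let h₀ , h₀∈𝓗 , _ = evades full (λ m → m , ≤-refl , tt) (λ _ → ∅ , Small-∅)
            h , h∈𝓗 , escapes = evades (met A A-inf)
              (met-infinite A A-inf h₀ (A⊆*capturing h₀ h₀∈𝓗)) (slalom A A-inf)
        in slalom-captures A A-inf h (𝓗≤b h h∈𝓗) (A⊆*capturing h h∈𝓗) escapes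
      where
      A⊆*capturing : ∀ h → h ∈ 𝓗 → A ⊆* capturing h
      A⊆*capturing h h∈𝓗 = diagonal (capturing h)
        (Generates.contains gen (capturing h) (∈-image⁺ capturing 𝓗 h∈𝓗))

  -- The common value of the four cardinals

  cardinals-equal : ∃ λ (κ : Set) → Is𝔣 κ × Is𝔣₁ κ × Is𝔣₂ κ × Is𝔢ubd κ
  cardinals-equal with minimum-exists 𝔣₁-family 𝔣₁-family-exists
  ... | 𝓗 , 𝓗-𝔣₁ , least = ∣ 𝓗 ∣ ,
    IsMinCard-transfer 𝔣₁⊑𝔣 𝔣⊑𝔣₁ 𝓗 𝓗-𝔣₁ least ,
    record { attained = 𝓗 , 𝓗-𝔣₁ , ↔-id _ ; least = least } ,
    IsMinCard-transfer 𝔣₁⊑𝔣₂ (⊑-trans 𝔣₂⊑𝔢ubd 𝔢ubd⊑𝔣₁) 𝓗 𝓗-𝔣₁ least ,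
    IsMinCard-transfer (⊑-trans 𝔣₁⊑𝔣₂ 𝔣₂⊑𝔢ubd) 𝔢ubd⊑𝔣₁ 𝓗 𝓗-𝔣₁ least

proposition2p2 : Classical → ∃ λ (κ : Set) → Is𝔣 κ × Is𝔣₁ κ × Is𝔣₂ κ × Is𝔢ubd κ
proposition2p2 = cardinals-equal
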